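{- For all integers $k \ge 5$, $$b_k(2) \le k^2 + k - 2.$$
   Context: For a positive integer $k$, $b_k(2)$ denotes the diagonal multicolor bipartite Ramsey number for the quadrilateral: the least positive integer $b$ such that any coloring of the edges of the complete bipartite graph $K_{b,b}$ with $k$ colors contains a monochromatic copy of $K_{2,2}=C_4$ (a 4-cycle all of whose edges have the same color). -}

module Defs where

open import Data.Nat using (ℕ; _≤_)
open import Data.Fin using (Fin)
open import Relation.Binary.PropositionalEquality using (_≡_; _≢_)

-- The edges of K_{b,b} are the pairs (left vertex, right vertex); a colouring
-- need not use all k colours.
EdgeColouring : ℕ → ℕ → Set
EdgeColouring k b = Fin b → Fin b → Fin k

-- As C₄ is connected, any copy of it in a bipartite graph has two vertices
-- u₁, u₂ on the left and two vertices v₁, v₂ on the right.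
record MonochromaticC₄ {k b : ℕ} (χ : EdgeColouring k b) : Set where
  field
    u₁ u₂   : Fin b
    v₁ v₂   : Fin b
    u₁≢u₂   : u₁ ≢ u₂
    v₁≢v₂   : v₁ ≢ v₂
    colour  : Fin k
    χu₁v₁   : χ u₁ v₁ ≡ colour
    χu₁v₂   : χ u₁ v₂ ≡ colour
    χu₂v₁   : χ u₂ v₁ ≡ colour
    χu₂v₂   : χ u₂ v₂ ≡ colour

ForcesC₄ : ℕ → ℕ → Set
ForcesC₄ k b = (χ : EdgeColouring k b) → MonochromaticC₄ χ

-- IsBipartiteRamsey k b says that b = b_k(2); such a b is unique.
record IsBipartiteRamsey (k b : ℕ) : Set where
  field
    positive : 1 ≤ b
    forces   : ForcesC₄ k b
    least    : ∀ c → 1 ≤ c → ForcesC₄ k c → b ≤ c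

{-# OPTIONS --safe #-}
module Submission where

-- Put n = k² + k − 2 and q = k² − k − 3, so that n − q = 2k + 1.  If no colour
-- contains a C₄, then every colour class has fewer than q(k+1) + (2k+1)k edges.
-- Otherwise its q vertices of largest degree on the left have total degree at
-- least q(k+1).  But any two of these vertices have at most one common
-- neighbour, so the right degrees s into them satisfy ∑ s(s−1) ≤ q(q−1),
-- whereas (s − (k−2))(s − (k−1)) ≥ 0 forces ∑ s(s−1) to exceed q(q−1) by at
-- least (k−1)(k−4) > 0.  Adding up the k colour classes then gives fewer
-- than n² edges.

open import Defs
open import Data.Nat using (ℕ; zero; suc; _+_; _*_; _∸_; _^_; _≤_; _<_; z≤n; s≤s; s≤s⁻¹; _≤?_)
open import Data.Nat.Properties hiding (_≟_; suc-injective; 0≢1+n)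
open import Data.Nat.Induction using (<-wellFounded)
open import Data.Nat.Tactic.RingSolver using (solve-∀)
open import Algebra.Properties.Semiring.Sum +-*-semiring
open import Data.Bool using (Bool; true; false; T; _∧_)
open import Data.Bool.Properties using (T-∧)
open import Data.Fin using (Fin; zero; suc; combine; remQuot; funToFin; finToFun)
open import Data.Fin.Properties using (_≟_; suc-injective; 0≢1+n; any?; all?; remQuot-combine; finToFun-funToFin)
open import Data.Product using (∃-syntax; _×_; _,_; uncurry)
open import Data.Sum using (_⊎_; inj₁; inj₂)
open import Data.Unit using (tt)
open import Function using (_∘_; id)
open import Function.Bundles using (Equivalence)
open import Function.Definitions using (Injective)
open import Induction.WellFounded using (Acc; acc)
open import Relation.Binary.PropositionalEquality using (_≡_; _≢_; refl; sym; trans; cong; cong₂; subst)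
open import Relation.Nullary using (¬_; Dec; yes; no; contradiction; ¬?; _×-dec_)
open import Relation.Nullary.Decidable using (⌊_⌋; map′; toWitness; fromWitness; decidable-stable)
open import Relation.Unary using (Pred; Decidable)

-- Sums of natural numbers

sum-mono-≤ : ∀ {n} {f g : Fin n → ℕ} → (∀ i → f i ≤ g i) → sum f ≤ sum g
sum-mono-≤ {zero}  f≤g = z≤n
sum-mono-≤ {suc n} f≤g = +-mono-≤ (f≤g zero) (sum-mono-≤ (f≤g ∘ suc))

sum-const : ∀ n x → ∑[ i < n ] x ≡ n * x
sum-const zero    x = refl
sum-const (suc n) x = cong (x +_) (sum-const n x)

term≤sum : ∀ {n} (f : Fin n → ℕ) i → f i ≤ sum f
term≤sum f zero    = m≤m+n (f zero) _
term≤sum f (suc i) = ≤-trans (term≤sum (f ∘ suc) i) (m≤n+m _ (f zero))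

sum-square : ∀ {n} (f : Fin n → ℕ) → sum f * sum f ≡ ∑[ i < n ] ∑[ i′ < n ] (f i * f i′)
sum-square f = trans (*-distribʳ-sum (sum f) f) (sum-cong-≗ (λ i → *-distribˡ-sum (f i) f))

-- The n - 1 values other than `f i` add at most n - 1; the 1 stands on the left to avoid
-- subtraction.
sum-≤1-elsewhere : ∀ {n} (f : Fin n → ℕ) i → (∀ j → i ≢ j → f j ≤ 1) → sum f + 1 ≤ f i + n
sum-≤1-elsewhere {suc n} f zero f≤1 = begin
  f zero + sum (f ∘ suc) + 1    ≤⟨ +-monoˡ-≤ 1 (+-monoʳ-≤ (f zero) (sum-mono-≤ (λ j → f≤1 (suc j) 0≢1+n))) ⟩
  f zero + (∑[ j < n ] 1) + 1   ≡⟨ cong (λ s → f zero + s + 1) (trans (sum-const n 1) (*-identityʳ n)) ⟩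
  f zero + n + 1                ≡⟨ +-assoc (f zero) n 1 ⟩
  f zero + (n + 1)              ≡⟨ cong (f zero +_) (+-comm n 1) ⟩
  f zero + suc n                ∎
  where open ≤-Reasoning
sum-≤1-elsewhere {suc n} f (suc i) f≤1 = begin
  f zero + sum (f ∘ suc) + 1    ≡⟨ +-assoc (f zero) _ 1 ⟩
  f zero + (sum (f ∘ suc) + 1)  ≤⟨ +-mono-≤ (f≤1 zero (0≢1+n ∘ sym)) (sum-≤1-elsewhere (f ∘ suc) i (λ j i≢j → f≤1 (suc j) (i≢j ∘ suc-injective))) ⟩
  suc (f (suc i) + n)           ≡⟨ +-suc (f (suc i)) n ⟨
  f (suc i) + suc n             ∎
  where open ≤-Reasoning

-- The second alternative arises when all of the r discarded values are at most d.
select-large : ∀ {n} q r d → q + r ≡ n → (f : Fin n → ℕ) →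
               ∃[ ρ ] (Injective {A = Fin q} _≡_ _≡_ ρ ×
                       ((∀ i → suc d ≤ f (ρ i)) ⊎ sum f ≤ sum (f ∘ ρ) + r * d))
select-large zero r d _ f = (λ ()) , (λ { {()} }) , inj₁ λ ()
select-large (suc q) zero d eq f rewrite sym eq | +-identityʳ q =
  id , id , inj₂ (m≤m+n (sum f) 0)
-- Greedy scan: a value above `d` takes one of the q places; any other is discarded and charged to
-- one of the r copies of `d`. If the places run out first, all chosen values exceed `d`; if the
-- discards do, the whole remainder is kept.
select-large (suc q) (suc r) d refl f with suc d ≤? f zero
... | yes d<f₀ with select-large q (suc r) d refl (f ∘ suc)
...   | ρ , ρ-inj , large = ρ′ , ρ′-inj , large′ large
  where
  ρ′ : Fin (suc q) → Fin (suc q + suc r)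
  ρ′ zero    = zero
  ρ′ (suc i) = suc (ρ i)
  ρ′-inj : Injective _≡_ _≡_ ρ′
  ρ′-inj {zero}  {zero}  _  = refl
  ρ′-inj {suc i} {suc j} eq = cong suc (ρ-inj (suc-injective eq))
  large′ : (∀ i → suc d ≤ f (suc (ρ i))) ⊎ sum (f ∘ suc) ≤ sum (f ∘ suc ∘ ρ) + suc r * d →
           (∀ i → suc d ≤ f (ρ′ i)) ⊎ sum f ≤ sum (f ∘ ρ′) + suc r * d
  large′ (inj₁ all) = inj₁ λ { zero → d<f₀ ; (suc i) → all i }
  large′ (inj₂ le)  = inj₂ (≤-trans (+-monoʳ-≤ (f zero) le) (≤-reflexive (sym (+-assoc (f zero) _ _))))
select-large (suc q) (suc r) d refl f | no d≮f₀
  with select-large (suc q) r d (sym (+-suc q r)) (f ∘ suc)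
... | ρ , ρ-inj , inj₁ all = suc ∘ ρ , ρ-inj ∘ suc-injective , inj₁ all
... | ρ , ρ-inj , inj₂ le  = suc ∘ ρ , ρ-inj ∘ suc-injective , inj₂ (begin
  f zero + sum (f ∘ suc)               ≤⟨ +-mono-≤ (s≤s⁻¹ (≰⇒> d≮f₀)) le ⟩
  d + (sum (f ∘ suc ∘ ρ) + r * d)      ≡⟨ swap d _ (r * d) ⟩
  sum (f ∘ suc ∘ ρ) + (d + r * d)      ∎)
  where
  open ≤-Reasoning
  swap : ∀ x y z → x + (y + z) ≡ y + (x + z)
  swap = solve-∀

-- Either each chosen value is at least `suc d`, or the discarded part, at most `r * d`, cancels.
-- The choice need not consist of the q largest values; only its total matters.
∃-heavy-subset : ∀ q r d (f : Fin (q + r) → ℕ) → q * suc d + r * d ≤ sum f →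
                 ∃[ ρ ] (Injective {A = Fin q} _≡_ _≡_ ρ × q * suc d ≤ sum (f ∘ ρ))
∃-heavy-subset q r d f large with select-large q r d refl f
... | ρ , ρ-inj , inj₁ all = ρ , ρ-inj , subst (_≤ sum (f ∘ ρ)) (sum-const q (suc d)) (sum-mono-≤ all)
... | ρ , ρ-inj , inj₂ le  = ρ , ρ-inj , +-cancelʳ-≤ (r * d) _ _ (≤-trans large le)

-- Zero-one matrices without all-ones 2 × 2 submatrices

⟦_⟧ : Bool → ℕ
⟦ false ⟧ = 0
⟦ true ⟧  = 1

⟦∧⟧ : ∀ a b → ⟦ a ⟧ * ⟦ b ⟧ ≡ ⟦ a ∧ b ⟧
⟦∧⟧ false b = refl
⟦∧⟧ true  b = +-identityʳ ⟦ b ⟧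

⟦⟧-idem : ∀ a → ⟦ a ⟧ * ⟦ a ⟧ ≡ ⟦ a ⟧
⟦⟧-idem false = refl
⟦⟧-idem true  = refl

T⇒1≤⟦⟧ : ∀ {a} → T a → 1 ≤ ⟦ a ⟧
T⇒1≤⟦⟧ {true} _ = ≤-refl

¬T⇒⟦⟧≡0 : ∀ {a} → ¬ T a → ⟦ a ⟧ ≡ 0
¬T⇒⟦⟧≡0 {false} _  = refl
¬T⇒⟦⟧≡0 {true}  ¬t = contradiction tt ¬t

count-unique≤1 : ∀ {n} (B : Fin n → Bool) → (∀ {j j′} → T (B j) → T (B j′) → j ≡ j′) →
                 ∑[ j < n ] ⟦ B j ⟧ ≤ 1
count-unique≤1 {zero}  B unique = z≤n
count-unique≤1 {suc n} B unique with B zero in eq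
... | false = count-unique≤1 (B ∘ suc) (λ p p′ → suc-injective (unique p p′))
... | true  = s≤s (begin
  ∑[ j < n ] ⟦ B (suc j) ⟧  ≡⟨ sum-cong-≗ {n} (λ j → ¬T⇒⟦⟧≡0 (λ p → 0≢1+n (unique (subst T (sym eq) tt) p))) ⟩
  ∑[ j < n ] 0              ≡⟨ sum-replicate-zero n ⟩
  0                         ∎)
  where open ≤-Reasoning

edges : ∀ {m n} → (Fin m → Fin n → Bool) → ℕ
edges {m} {n} A = ∑[ i < m ] ∑[ j < n ] ⟦ A i j ⟧

C₄-Free : ∀ {m n} → (Fin m → Fin n → Bool) → Set
C₄-Free A = ∀ {i i′ j j′} → i ≢ i′ →
            T (A i j) → T (A i j′) → T (A i′ j) → T (A i′ j′) → j ≡ j′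

-- ∑ s² ≤ e + m(m − 1), with both sides moved so that no subtraction occurs.
∑-column-degree² : ∀ {m n} (A : Fin m → Fin n → Bool) → C₄-Free A →
  let s = λ j → ∑[ i < m ] ⟦ A i j ⟧ in
  ∑[ j < n ] (s j * s j) + m ≤ edges A + m * m
∑-column-degree² {m} {n} A free = begin
  ∑[ j < n ] (s j * s j) + m
    -- Double counting: ∑ s² counts a column with an ordered pair of rows meeting it, equal rows
    -- included; exchanging sums groups these by the pair of rows.
    ≡⟨ cong (_+ m) (sum-cong-≗ (λ j → sum-square (λ i → ⟦ A i j ⟧))) ⟩
  (∑[ j < n ] ∑[ i < m ] ∑[ i′ < m ] (⟦ A i j ⟧ * ⟦ A i′ j ⟧)) + m
    ≡⟨ cong (_+ m) (∑-comm (λ j i → ∑[ i′ < m ] (⟦ A i j ⟧ * ⟦ A i′ j ⟧))) ⟩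
  (∑[ i < m ] ∑[ j < n ] ∑[ i′ < m ] (⟦ A i j ⟧ * ⟦ A i′ j ⟧)) + m
    ≡⟨ cong (_+ m) (sum-cong-≗ (λ i → ∑-comm (λ j i′ → ⟦ A i j ⟧ * ⟦ A i′ j ⟧))) ⟩
  (∑[ i < m ] ∑[ i′ < m ] common i i′) + m
    ≡⟨ cong ((∑[ i < m ] ∑[ i′ < m ] common i i′) +_) (trans (sum-const m 1) (*-identityʳ m)) ⟨
  (∑[ i < m ] ∑[ i′ < m ] common i i′) + (∑[ i < m ] 1)
    ≡⟨ ∑-distrib-+ (λ i → ∑[ i′ < m ] common i i′) (λ _ → 1) ⟨
  ∑[ i < m ] ((∑[ i′ < m ] common i i′) + 1)
    -- Row `i` shares at most one column with each of the m - 1 other rows, and its whole degree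
    -- with itself.
    ≤⟨ sum-mono-≤ (λ i → sum-≤1-elsewhere (common i) i (λ i′ → common≤1)) ⟩
  ∑[ i < m ] (common i i + m)
    ≡⟨ ∑-distrib-+ (λ i → common i i) (λ _ → m) ⟩
  (∑[ i < m ] common i i) + (∑[ i < m ] m)
    ≡⟨ cong₂ _+_ (sum-cong-≗ (λ i → sum-cong-≗ (λ j → ⟦⟧-idem (A i j)))) (sum-const m m) ⟩
  edges A + m * m ∎
  where
  open ≤-Reasoning
  s : Fin n → ℕ
  s j = ∑[ i < m ] ⟦ A i j ⟧
  common : Fin m → Fin m → ℕ
  common i i′ = ∑[ j < n ] (⟦ A i j ⟧ * ⟦ A i′ j ⟧)
  common≤1 : ∀ {i i′} → i ≢ i′ → common i i′ ≤ 1
  common≤1 {i} {i′} i≢i′ = begin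
    common i i′                      ≡⟨ sum-cong-≗ (λ j → ⟦∧⟧ (A i j) (A i′ j)) ⟩
    ∑[ j < n ] ⟦ A i j ∧ A i′ j ⟧    ≤⟨ count-unique≤1 (λ j → A i j ∧ A i′ j) unique ⟩
    1                                ∎
    where
    unique : ∀ {j j′} → T (A i j ∧ A i′ j) → T (A i j′ ∧ A i′ j′) → j ≡ j′
    unique p p′ with Equivalence.to T-∧ p | Equivalence.to T-∧ p′
    ... | a , b | a′ , b′ = free i≢i′ a a′ b b′

-- (s − c)(s − c − 1) ≥ 0 over the integers.
tangent-≤-square : ∀ c s → (2 * c + 1) * s ≤ s * s + c * suc c
-- In both cases `o * o + o` is the product (s - c)(s - c - 1), with o = c - s or o = s - c - 1.
tangent-≤-square c s with ≤-<-connex s c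
... | inj₁ s≤c with m≤n⇒∃[o]m+o≡n s≤c
...   | o , refl = ≤-trans (m≤m+n _ (o * o + o)) (≤-reflexive (identity s o))
  where
  identity : ∀ s o → (2 * (s + o) + 1) * s + (o * o + o) ≡ s * s + (s + o) * suc (s + o)
  identity = solve-∀
tangent-≤-square c s | inj₂ c<s with m≤n⇒∃[o]m+o≡n c<s
...   | o , refl = ≤-trans (m≤m+n _ (o * o + o)) (≤-reflexive (identity c o))
  where
  identity : ∀ c o → (2 * c + 1) * (suc c + o) + (o * o + o) ≡ (suc c + o) * (suc c + o) + c * suc c
  identity = solve-∀

-- Summing the tangent inequality over the columns bounds (2c + 1)e by ∑ s² and a constant;
-- `∑-column-degree²` puts one e on the right, which cancels. The bound is sharpest when column
-- degrees are near `c` and `suc c`.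
C₄-free-edges : ∀ {m n} c (A : Fin m → Fin n → Bool) → C₄-Free A →
                2 * c * edges A + m ≤ m * m + n * (c * suc c)
C₄-free-edges {m} {n} c A free = +-cancelˡ-≤ (edges A) _ _ (begin
  edges A + (2 * c * edges A + m)
    ≡⟨ regroup c (edges A) m ⟩
  (2 * c + 1) * edges A + m
    ≡⟨ cong (λ e → (2 * c + 1) * e + m) (∑-comm (λ i j → ⟦ A i j ⟧)) ⟩
  (2 * c + 1) * sum s + m
    ≡⟨ cong (_+ m) (*-distribˡ-sum (2 * c + 1) s) ⟩
  ∑[ j < n ] ((2 * c + 1) * s j) + m
    ≤⟨ +-monoˡ-≤ m (sum-mono-≤ (λ j → tangent-≤-square c (s j))) ⟩
  ∑[ j < n ] (s j * s j + c * suc c) + m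
    ≡⟨ cong (_+ m) (∑-distrib-+ (λ j → s j * s j) (λ _ → c * suc c)) ⟩
  (∑[ j < n ] (s j * s j)) + (∑[ j < n ] (c * suc c)) + m
    ≡⟨ cong (λ z → (∑[ j < n ] (s j * s j)) + z + m) (sum-const n (c * suc c)) ⟩
  (∑[ j < n ] (s j * s j)) + n * (c * suc c) + m
    ≡⟨ swap (∑[ j < n ] (s j * s j)) (n * (c * suc c)) m ⟩
  (∑[ j < n ] (s j * s j)) + m + n * (c * suc c)
    ≤⟨ +-monoˡ-≤ (n * (c * suc c)) (∑-column-degree² A free) ⟩
  edges A + m * m + n * (c * suc c)
    ≡⟨ +-assoc (edges A) (m * m) _ ⟩
  edges A + (m * m + n * (c * suc c)) ∎)
  where
  open ≤-Reasoning
  s : Fin n → ℕ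
  s j = ∑[ i < m ] ⟦ A i j ⟧
  regroup : ∀ c e m → e + (2 * c * e + m) ≡ (2 * c + 1) * e + m
  regroup = solve-∀
  swap : ∀ x y z → x + y + z ≡ x + z + y
  swap = solve-∀

C₄-free-heavy-rows : ∀ {n} q r d c (A : Fin (q + r) → Fin n → Bool) → C₄-Free A →
                     q * suc d + r * d ≤ edges A →
                     2 * c * (q * suc d) + q ≤ q * q + n * (c * suc c)
C₄-free-heavy-rows {n} q r d c A free large
  with ∃-heavy-subset q r d (λ i → ∑[ j < n ] ⟦ A i j ⟧) large
... | ρ , ρ-inj , heavy = ≤-trans
  (+-monoˡ-≤ q (*-monoʳ-≤ (2 * c) heavy))
  (C₄-free-edges c (A ∘ ρ) (λ i≢i′ → free (i≢i′ ∘ ρ-inj)))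

-- Colourings with k = 5 + t colours

-- k² − k − 3, 2k + 1 and k² + k − 2 at k = 5 + t, free of subtraction.
heavy light order : ℕ → ℕ
heavy t = t * t + 9 * t + 17
light t = 2 * t + 11
order t = heavy t + light t

-- The threshold of `C₄-free-heavy-rows` at d = k: the edge count when `heavy t` rows have degree k
-- + 1 and `light t` rows have degree k.
edgeBound : ℕ → ℕ
edgeBound t = heavy t * suc (5 + t) + light t * (5 + t)

C₄-free-edges<edgeBound : ∀ t (A : Fin (order t) → Fin (order t) → Bool) → C₄-Free A →
                          edges A < edgeBound t
C₄-free-edges<edgeBound t A free = ≰⇒> λ large →
  -- Here c = `3 + t` = k - 2, because q(k + 1) edges spread over n columns give an average degree
  -- between k - 2 and k - 1.
  m+1+n≰m bound (subst (_≤ bound) (excess t)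
    (C₄-free-heavy-rows (heavy t) (light t) (5 + t) (3 + t) A free large))
  where
  bound : ℕ
  bound = heavy t * heavy t + order t * ((3 + t) * suc (3 + t))
  excess : ∀ t →
    let q = t * t + 9 * t + 17 in
    2 * (3 + t) * (q * suc (5 + t)) + q ≡
    q * q + (q + (2 * t + 11)) * ((3 + t) * suc (3 + t)) + suc (t * t + 5 * t + 3)
  excess = solve-∀

colourClass : ∀ {k b} → EdgeColouring k b → Fin k → Fin b → Fin b → Bool
colourClass χ c i j = ⌊ χ i j ≟ c ⌋

colourClass-C₄-free : ∀ {k b} (χ : EdgeColouring k b) → ¬ MonochromaticC₄ χ →
                      ∀ c → C₄-Free (colourClass χ c)
colourClass-C₄-free χ ¬mono c {i} {i′} {j} {j′} i≢i′ p₁₁ p₁₂ p₂₁ p₂₂ =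
  decidable-stable (j ≟ j′) λ j≢j′ → ¬mono record
    { u₁ = i ; u₂ = i′ ; v₁ = j ; v₂ = j′ ; u₁≢u₂ = i≢i′ ; v₁≢v₂ = j≢j′ ; colour = c
    ; χu₁v₁ = toWitness p₁₁ ; χu₁v₂ = toWitness p₁₂
    ; χu₂v₁ = toWitness p₂₁ ; χu₂v₂ = toWitness p₂₂ }

colourClasses-cover : ∀ {k b} (χ : EdgeColouring k b) →
                      b * b ≤ ∑[ c < k ] edges (colourClass χ c)
colourClasses-cover {k} {b} χ = begin
  b * b
    ≡⟨ sum-const b b ⟨
  ∑[ i < b ] b
    ≡⟨ sum-cong-≗ (λ (i : Fin b) → trans (sum-const b 1) (*-identityʳ b)) ⟨
  ∑[ i < b ] ∑[ j < b ] 1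
    ≤⟨ sum-mono-≤ (λ i → sum-mono-≤ (λ j → coloured i j)) ⟩
  ∑[ i < b ] ∑[ j < b ] ∑[ c < k ] ⟦ colourClass χ c i j ⟧
    ≡⟨ sum-cong-≗ (λ i → ∑-comm (λ j c → ⟦ colourClass χ c i j ⟧)) ⟩
  ∑[ i < b ] ∑[ c < k ] ∑[ j < b ] ⟦ colourClass χ c i j ⟧
    ≡⟨ ∑-comm (λ i c → ∑[ j < b ] ⟦ colourClass χ c i j ⟧) ⟩
  ∑[ c < k ] edges (colourClass χ c) ∎
  where
  open ≤-Reasoning
  coloured : ∀ i j → 1 ≤ ∑[ c < k ] ⟦ colourClass χ c i j ⟧
  coloured i j = ≤-trans (T⇒1≤⟦⟧ (fromWitness {a? = χ i j ≟ χ i j} refl))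
                         (term≤sum (λ c → ⟦ colourClass χ c i j ⟧) (χ i j))

-- The summand k on the left records the edge that strictness saves in each colour.
pigeonhole : ∀ {k b} E (χ : EdgeColouring k b) → (∀ c → edges (colourClass χ c) < E) →
             k + b * b ≤ k * E
pigeonhole {k} {b} E χ e<E = begin
  k + b * b                          ≤⟨ +-monoʳ-≤ k (colourClasses-cover χ) ⟩
  k + (∑[ c < k ] e c)               ≡⟨ cong (_+ (∑[ c < k ] e c)) (trans (sum-const k 1) (*-identityʳ k)) ⟨
  (∑[ c < k ] 1) + (∑[ c < k ] e c)  ≡⟨ ∑-distrib-+ (λ _ → 1) e ⟨
  ∑[ c < k ] suc (e c)               ≤⟨ sum-mono-≤ e<E ⟩
  ∑[ c < k ] E                       ≡⟨ sum-const k E ⟩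
  k * E                              ∎
  where
  open ≤-Reasoning
  e : Fin k → ℕ
  e c = edges (colourClass χ c)

-- With E = `edgeBound t`, k + n² equals kE + 4, against `pigeonhole`; `{3}` encodes this surplus as
-- `suc 3`. As k > 4, the edge saved per colour is decisive.
¬C₄-free-colouring : ∀ t (χ : EdgeColouring (5 + t) (order t)) → ¬ ¬ MonochromaticC₄ χ
¬C₄-free-colouring t χ ¬mono = m+1+n≰m ((5 + t) * edgeBound t) {3}
  (subst (_≤ (5 + t) * edgeBound t) (total t)
    (pigeonhole (edgeBound t) χ λ c →
      C₄-free-edges<edgeBound t (colourClass χ c) (colourClass-C₄-free χ ¬mono c)))
  where
  total : ∀ t →
    let q = t * t + 9 * t + 17
        r = 2 * t + 11 in
    (5 + t) + (q + r) * (q + r) ≡ (5 + t) * (q * suc (5 + t) + r * (5 + t)) + 4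
  total = solve-∀

-- Decidability and minimality

monochromaticC₄? : ∀ {k b} (χ : EdgeColouring k b) → Dec (MonochromaticC₄ χ)
monochromaticC₄? χ = map′
  (λ (u₁ , u₂ , v₁ , v₂ , u≢ , v≢ , p , q , r) → record
    { u₁ = u₁ ; u₂ = u₂ ; v₁ = v₁ ; v₂ = v₂ ; u₁≢u₂ = u≢ ; v₁≢v₂ = v≢ ; colour = χ u₁ v₁
    ; χu₁v₁ = refl ; χu₁v₂ = p ; χu₂v₁ = q ; χu₂v₂ = r })
  (λ m → let open MonochromaticC₄ m in
    u₁ , u₂ , v₁ , v₂ , u₁≢u₂ , v₁≢v₂ ,
    trans χu₁v₂ (sym χu₁v₁) , trans χu₂v₁ (sym χu₁v₁) , trans χu₂v₂ (sym χu₁v₁))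
  -- The colour must be that of `χ u₁ v₁`, so the search runs over vertices alone.
  (any? λ u₁ → any? λ u₂ → any? λ v₁ → any? λ v₂ →
    ¬? (u₁ ≟ u₂) ×-dec ¬? (v₁ ≟ v₂) ×-dec
    (χ u₁ v₂ ≟ χ u₁ v₁) ×-dec (χ u₂ v₁ ≟ χ u₁ v₁) ×-dec (χ u₂ v₂ ≟ χ u₁ v₁))

-- Decoding an encoded colouring recovers it only pointwise, so the property has to be carried along
-- pointwise equality.
monochromaticC₄-resp : ∀ {k b} {χ χ′ : EdgeColouring k b} → (∀ i j → χ i j ≡ χ′ i j) →
                       MonochromaticC₄ χ → MonochromaticC₄ χ′
monochromaticC₄-resp χ≗χ′ m = record
  { u₁ = u₁ ; u₂ = u₂ ; v₁ = v₁ ; v₂ = v₂ ; u₁≢u₂ = u₁≢u₂ ; v₁≢v₂ = v₁≢v₂ ; colour = colour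
  ; χu₁v₁ = trans (sym (χ≗χ′ u₁ v₁)) χu₁v₁ ; χu₁v₂ = trans (sym (χ≗χ′ u₁ v₂)) χu₁v₂
  ; χu₂v₁ = trans (sym (χ≗χ′ u₂ v₁)) χu₂v₁ ; χu₂v₂ = trans (sym (χ≗χ′ u₂ v₂)) χu₂v₂ }
  where open MonochromaticC₄ m

-- Colourings as b²-digit numbers in base k, so that quantifying over all of them becomes a finite
-- check.
decode : ∀ {k b} → Fin (k ^ (b * b)) → EdgeColouring k b
decode x i j = finToFun x (combine i j)

encode : ∀ {k b} → EdgeColouring k b → Fin (k ^ (b * b))
encode {b = b} χ = funToFin (uncurry χ ∘ remQuot b)

decode-encode : ∀ {k b} (χ : EdgeColouring k b) i j → decode (encode χ) i j ≡ χ i j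
decode-encode {b = b} χ i j = trans
  (finToFun-funToFin (uncurry χ ∘ remQuot b) (combine i j))
  (cong (uncurry χ) (remQuot-combine i j))

forcesC₄? : ∀ k b → Dec (ForcesC₄ k b)
forcesC₄? k b = map′
  (λ forces χ → monochromaticC₄-resp (decode-encode χ) (forces (encode χ)))
  (λ forces x → forces (decode x))
  (all? (λ x → monochromaticC₄? (decode x)))

least : ∀ {p} {P : Pred ℕ p} → Decidable P → ∀ n → P n →
        ∃[ m ] (P m × m ≤ n × (∀ c → P c → m ≤ c))
least {P = P} P? n = go n (<-wellFounded n)
  where
  go : ∀ n → Acc _<_ n → P n → ∃[ m ] (P m × m ≤ n × (∀ c → P c → m ≤ c))
  go n (acc rec) Pn with anyUpTo? P? n
  ... | no none = n , Pn , ≤-refl , λ c Pc → ≮⇒≥ (λ c<n → none (c , c<n , Pc))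
  ... | yes (m , m<n , Pm) with go m (rec m<n) Pm
  ...   | l , Pl , l≤m , l-least = l , Pl , ≤-trans l≤m (<⇒≤ m<n) , l-least

-- One forcing order suffices for the Ramsey number to exist: forcing is decidable, so a least
-- positive forcing order can be found below it.
ramsey-≤ : ∀ {k n} → 1 ≤ n → ForcesC₄ k n → ∃[ b ] (IsBipartiteRamsey k b × b ≤ n)
ramsey-≤ {k} {n} 1≤n forces-n
  with least (λ c → (1 ≤? c) ×-dec forcesC₄? k c) n (1≤n , forces-n)
... | b , (positive , forces) , b≤n , b-least =
  b , record { positive = positive ; forces = forces ; least = λ c 1≤c f → b-least c (1≤c , f) } , b≤n

theorem8 : ∀ (k : ℕ) → 5 ≤ k → ∃[ b ] (IsBipartiteRamsey k b × b ≤ k ^ 2 + k ∸ 2)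
theorem8 k 5≤k with m≤n⇒∃[o]m+o≡n 5≤k
... | t , refl = subst (λ n → ∃[ b ] (IsBipartiteRamsey (5 + t) b × b ≤ n)) (cong (_∸ 2) (order-eq t))
  (ramsey-≤ 1≤order (λ χ → decidable-stable (monochromaticC₄? χ) (¬C₄-free-colouring t χ)))
  where
  1≤order : 1 ≤ order t
  1≤order = ≤-trans (s≤s z≤n) (≤-trans (m≤n+m 11 (2 * t)) (m≤n+m (light t) (heavy t)))
  -- The 2 stands on the left so that `_∸ 2` computes away; the right side is
  -- `(5 + t) ^ 2 + (5 + t)` unfolded.
  order-eq : ∀ t → 2 + ((t * t + 9 * t + 17) + (2 * t + 11)) ≡ (5 + t) * ((5 + t) * 1) + (5 + t)
  order-eq = solve-∀
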